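{- Let $w_1,w_2,w_3$ be any odd positive integers, let $n\ge 0$ be an integer and let $y_1,y_2\in\mathbb{Z}_p$. Then \begin{align*} &w_1^{n}\sum_{k=0}^{n}\binom{n}{k}E_{k,q^{w_1w_2}}(w_3y_1)\,w_3^{n-k}w_2^{k}\sum_{i=0}^{w_1-1}(-1)^{i}q^{w_2w_3i}E_{n-k,q^{w_1w_3}}\Big(w_2y_2+\frac{w_2}{w_1}i\Big)\\ =&\,w_1^{n}\sum_{k=0}^{n}\binom{n}{k}E_{k,q^{w_1w_3}}(w_2y_1)\,w_2^{n-k}w_3^{k}\sum_{i=0}^{w_1-1}(-1)^{i}q^{w_2w_3i}E_{n-k,q^{w_1w_2}}\Big(w_3y_2+\frac{w_3}{w_1}i\Big)\\ =&\,w_2^{n}\sum_{k=0}^{n}\binom{n}{k}E_{k,q^{w_1w_2}}(w_3y_1)\,w_3^{n-k}w_1^{k}\sum_{i=0}^{w_2-1}(-1)^{i}q^{w_1w_3i}E_{n-k,q^{w_2w_3}}\Big(w_1y_2+\frac{w_1}{w_2}i\Big)\\ =&\,w_2^{n}\sum_{k=0}^{n}\binom{n}{k}E_{k,q^{w_2w_3}}(w_1y_1)\,w_1^{n-k}w_3^{k}\sum_{i=0}^{w_2-1}(-1)^{i}q^{w_1w_3i}E_{n-k,q^{w_1w_2}}\Big(w_3y_2+\frac{w_3}{w_2}i\Big)\\ =&\,w_3^{n}\sum_{k=0}^{n}\binom{n}{k}E_{k,q^{w_1w_3}}(w_2y_1)\,w_2^{n-k}w_1^{k}\sum_{i=0}^{w_3-1}(-1)^{i}q^{w_1w_2i}E_{n-k,q^{w_2w_3}}\Big(w_1y_2+\frac{w_1}{w_3}i\Big)\\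 =&\,w_3^{n}\sum_{k=0}^{n}\binom{n}{k}E_{k,q^{w_2w_3}}(w_1y_1)\,w_1^{n-k}w_2^{k}\sum_{i=0}^{w_3-1}(-1)^{i}q^{w_1w_2i}E_{n-k,q^{w_1w_3}}\Big(w_2y_2+\frac{w_2}{w_3}i\Big). \end{align*}
   Context: Let $p$ be a fixed odd prime, $\mathbb{C}_p$ the completion of an algebraic closure of $\mathbb{Q}_p$ with absolute value normalized by $|p|_p=1/p$, and let $q\in\mathbb{C}_p$ be fixed with $|q-1|_p<p^{ -1/(p-1)}$. For $r\in\mathbb{C}_p$ with $|r-1|_p<p^{ -1/(p-1)}$ (in particular for $r=q^w$, $w$ a positive integer), the $r$-Euler polynomials $E_{n,r}(x)$ ($n\ge 0$) are the polynomials in $x$ defined by the generating function $$\frac{2}{re^{t}+1}e^{xt}=\sum_{n=0}^{\infty}E_{n,r}(x)\frac{t^n}{n!}.$$ -}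

module Defs where

open import Algebra.Apartness.Bundles using (HeytingField)
open import Algebra.Bundles using (CommutativeRing)
open import Algebra.Morphism.Structures using (IsRingHomomorphism)
import Algebra.Properties.Semiring.Exp as Exp
import Algebra.Properties.Semiring.Mult as Mult
import Algebra.Properties.Semiring.Sum as Sum
open import Data.Fin.Base using (Fin; toℕ)
import Data.Integer.Base as ℤ
open import Data.List.Base using (length; filter; upTo)
open import Data.Nat.Base as ℕ using (ℕ; zero; suc; _∸_; _!; NonZero)
open import Data.Nat.Divisibility using (_∣_; _∣?_)
open import Data.Nat.Primality using (Prime)
open import Data.Product.Base using (Σ-syntax; ∃-syntax; _,_; proj₁)
open import Data.Rational.Base as ℚ using (ℚ; 0ℚ; ↥_; ↧ₙ_)
import Data.Rational.Properties as ℚ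
open import Data.Vec.Base using (Vec; []; _∷_; head; lookup)
open import Function.Bundles using (_⇔_; Equivalence)
open import Level using (Level; _⊔_) renaming (suc to lsuc)
open import Relation.Binary.Construct.Add.Infimum.NonStrict ℚ._≤_ using (_≤₋_)
open import Relation.Binary.Construct.Add.Infimum.Strict ℚ._<_ using (_<₋_)
open import Relation.Binary.PropositionalEquality.Core using (_≡_; _≢_)
open import Relation.Nullary.Construct.Add.Infimum using (_₋; ⊥₋; [_])
open import Relation.Nullary.Negation.Core using (¬_)

Odd : ℕ → Set
Odd n = ¬ (2 ∣ n)

------------------------------------------------------------------------
-- Absolute values

-- All p-adic absolute values lie in {0} ∪ { pˢ ∣ s ∈ ℚ } ⊂ ℝ: the value
-- group of an algebraic closure of ℚₚ is p^ℚ, and completing does not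
-- enlarge it.  The number pˢ is represented by its exponent s; since p > 1,
-- the order of ℝ is the order of the exponents, with 0 as least element.

Magnitude : Set
Magnitude = ℚ ₋

pattern 𝟎    = ⊥₋
pattern p^ s = [ s ]

infixl 7 _·_
infixl 6 _⊔ᵐ_
infix  4 _≤ᵐ_ _<ᵐ_

_≤ᵐ_ _<ᵐ_ : Magnitude → Magnitude → Set
_≤ᵐ_ = _≤₋_
_<ᵐ_ = _<₋_

_·_ : Magnitude → Magnitude → Magnitude
𝟎    · _    = 𝟎
p^ _ · 𝟎    = 𝟎
p^ s · p^ t = p^ (s ℚ.+ t)

_⊔ᵐ_ : Magnitude → Magnitude → Magnitude
𝟎    ⊔ᵐ b    = b
p^ s ⊔ᵐ 𝟎    = p^ s
p^ s ⊔ᵐ p^ t = p^ (s ℚ.⊔ t)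

-- The multiplicity of p in n, for p ≥ 2 and n ≥ 1: the number of exponents
-- k ≥ 1 with pᵏ ∣ n; all of these satisfy k ≤ n.
ord : ℕ → ℕ → ℕ
ord p n = length (filter (λ k → p ℕ.^ suc k ∣? n) (upTo n))

-- The p-adic absolute value of ℚ, normalised by ∣ p ∣ = p⁻¹.
∣_∣ℚ[_] : ℚ → ℕ → Magnitude
∣ x ∣ℚ[ p ] with ℤ.∣ ↥ x ∣
... | zero      = 𝟎
... | m@(suc _) = p^ ((ℤ.+ ord p (↧ₙ x) ℤ.- ℤ.+ ord p m) ℚ./ 1)

------------------------------------------------------------------------
-- Fields with an absolute value

module FieldOps {c ℓ₁ ℓ₂} (F : HeytingField c ℓ₁ ℓ₂) where
  open HeytingField F public

  commutativeRing : CommutativeRing c ℓ₁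
  commutativeRing = record { isCommutativeRing = isCommutativeRing }

  open CommutativeRing commutativeRing public
    using (semiring; rawRing)
  open Exp semiring public using (_^_)
  open Sum semiring public using (sum-syntax; sum⁺-syntax)
  open Mult semiring using () renaming (_×_ to _⋆_)

  ⟨_⟩ : ℕ → Carrier
  ⟨ n ⟩ = n ⋆ 1#

  -- xⁿ + aₙ₋₁xⁿ⁻¹ + ⋯ + a₀
  monic : (n : ℕ) → (Fin n → Carrier) → Carrier → Carrier
  monic n a x = x ^ n + ∑[ i < n ] (a i * x ^ toℕ i)

record ValuedField (c ℓ₁ ℓ₂ : Level) : Set (lsuc (c ⊔ ℓ₁ ⊔ ℓ₂)) where
  field
    heytingField : HeytingField c ℓ₁ ℓ₂

  open FieldOps heytingField public

  field
    ∣_∣          : Carrier → Magnitude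
    ∣∣-cong      : ∀ {x y} → x ≈ y → ∣ x ∣ ≡ ∣ y ∣
    #0⇔∣∣≢𝟎      : ∀ {x} → (x # 0#) ⇔ (∣ x ∣ ≢ 𝟎)
    ∣∣-homo-*    : ∀ x y → ∣ x * y ∣ ≡ ∣ x ∣ · ∣ y ∣
    ∣∣-ultraNorm : ∀ x y → ∣ x + y ∣ ≤ᵐ ∣ x ∣ ⊔ᵐ ∣ y ∣

  Cauchy : (ℕ → Carrier) → Set
  Cauchy u = ∀ s → ∃[ N ] (∀ m n → N ℕ.≤ m → N ℕ.≤ n → ∣ u m - u n ∣ <ᵐ p^ s)

  Converges : (ℕ → Carrier) → Carrier → Set
  Converges u x = ∀ s → ∃[ N ] (∀ n → N ℕ.≤ n → ∣ u n - x ∣ <ᵐ p^ s)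

  Complete : Set c
  Complete = ∀ u → Cauchy u → ∃[ x ] Converges u x

  -- The inverse of x, with the convention 0⁻¹ = 0.
  infix 9 _⁻¹
  _⁻¹ : Carrier → Carrier
  x ⁻¹ = go ∣ x ∣ _≡_.refl
    where
    go : (a : Magnitude) → ∣ x ∣ ≡ a → Carrier
    go 𝟎      _  = 0#
    go (p^ s) eq = proj₁ (#⇒invertible {x} {0#} (Equivalence.from #0⇔∣∣≢𝟎 ∣x∣≢𝟎))
      where
      ∣x∣≢𝟎 : ∣ x ∣ ≢ 𝟎
      ∣x∣≢𝟎 rewrite eq = λ ()

  infixl 7 _/_
  _/_ : Carrier → Carrier → Carrier
  x / y = x * y ⁻¹

-- (L, ι) is the completion of F with respect to the absolute value ∣_∣F.
record IsCompletion {a m₁ m₂ c ℓ₁ ℓ₂}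
  (F : HeytingField a m₁ m₂) (∣_∣F : HeytingField.Carrier F → Magnitude)
  (L : ValuedField c ℓ₁ ℓ₂)
  (ι : HeytingField.Carrier F → ValuedField.Carrier L)
  : Set (a ⊔ m₁ ⊔ c ⊔ ℓ₁) where
  private module L = ValuedField L
  field
    isRingHomomorphism : IsRingHomomorphism (FieldOps.rawRing F) L.rawRing ι
    isometry           : ∀ x → L.∣ ι x ∣ ≡ ∣ x ∣F
    dense              : ∀ y s → ∃[ x ] (L.∣ y L.- ι x ∣ <ᵐ p^ s)
    complete           : L.Complete

-- (L, ι) is an algebraic closure of F, and the absolute value of L extends
-- that of F.
record IsValuedAlgebraicClosure {a m₁ m₂ c ℓ₁ ℓ₂}
  (F : ValuedField a m₁ m₂) (L : ValuedField c ℓ₁ ℓ₂)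
  (ι : ValuedField.Carrier F → ValuedField.Carrier L)
  : Set (a ⊔ m₁ ⊔ c ⊔ ℓ₁) where
  private
    module F = ValuedField F
    module L = ValuedField L
  field
    isRingHomomorphism  : IsRingHomomorphism F.rawRing L.rawRing ι
    isometry            : ∀ x → L.∣ ι x ∣ ≡ F.∣ x ∣
    algebraic           : ∀ y → ∃[ n ] Σ[ a ∈ (Fin n → F.Carrier) ]
                            L.monic n (λ i → ι (a i)) y L.≈ L.0#
    algebraicallyClosed : ∀ n (a : Fin (suc n) → L.Carrier) →
                            ∃[ y ] L.monic (suc n) a y L.≈ L.0#

-- The tower ℚ → ℚₚ → ℚₚᵃ → ℂₚ, which these conditions determine up to
-- isometric isomorphism.
record PAdicTower (p : ℕ) (c ℓ₁ ℓ₂ : Level) : Set (lsuc (c ⊔ ℓ₁ ⊔ ℓ₂)) where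
  field
    ℚₚ ℚₚᵃ ℂₚ : ValuedField c ℓ₁ ℓ₂

  module ℚₚ  = ValuedField ℚₚ
  module ℚₚᵃ = ValuedField ℚₚᵃ
  module ℂₚ  = ValuedField ℂₚ

  field
    ι₁ : ℚ → ℚₚ.Carrier
    ι₂ : ℚₚ.Carrier → ℚₚᵃ.Carrier
    ι₃ : ℚₚᵃ.Carrier → ℂₚ.Carrier
    isCompletion₁            : IsCompletion ℚ.heytingField ∣_∣ℚ[ p ] ℚₚ ι₁
    isValuedAlgebraicClosure : IsValuedAlgebraicClosure ℚₚ ℚₚᵃ ι₂
    isCompletion₃            : IsCompletion ℚₚᵃ.heytingField ℚₚᵃ.∣_∣ ℂₚ ι₃

  ℤₚ : Set c
  ℤₚ = Σ[ y ∈ ℚₚ.Carrier ] (ℚₚ.∣ y ∣ ≤ᵐ p^ 0ℚ)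

  fromℤₚ : ℤₚ → ℂₚ.Carrier
  fromℤₚ (y , _) = ι₃ (ι₂ y)

-- p^(-1/(p-1))
radius : (p : ℕ) → Prime p → Magnitude
radius p pr = p^ (ℚ.- (ℤ.+ 1 ℚ./ (p ∸ 1)))
  where
  instance
    p∸1≢0 : NonZero (p ∸ 1)
    p∸1≢0 = nz p pr
      where
      nz : ∀ m → Prime m → NonZero (m ∸ 1)
      nz (suc (suc m)) _ = _

------------------------------------------------------------------------
-- Formal power series in t and the r-Euler polynomials

module Euler {c ℓ₁ ℓ₂} (K : ValuedField c ℓ₁ ℓ₂) where
  open ValuedField K

  Series : Set c
  Series = ℕ → Carrier

  infixl 7 _∗_
  infixl 6 _⊞_

  const : Carrier → Series
  const a zero    = a
  const a (suc _) = 0#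

  _⊞_ _∗_ : Series → Series → Series
  (f ⊞ g) n = f n + g n
  (f ∗ g) n = ∑[ k ≤ n ] (f (toℕ k) * g (n ∸ toℕ k))

  -- The coefficients bₙ, …, b₀ of 1/f, in this order:
  -- b₀ = f₀⁻¹ and bₙ₊₁ = - f₀⁻¹ (f₁bₙ + f₂bₙ₋₁ + ⋯ + fₙ₊₁b₀).
  recipCoeffs : Series → (n : ℕ) → Vec Carrier (suc n)
  recipCoeffs f zero    = f 0 ⁻¹ ∷ []
  recipCoeffs f (suc n) = - (f 0 ⁻¹) * ∑[ j ≤ n ] (f (suc (toℕ j)) * lookup bs j) ∷ bs
    where bs = recipCoeffs f n

  recip : Series → Series
  recip f n = head (recipCoeffs f n)

  -- e^(xt)
  exp : Carrier → Series
  exp x n = x ^ n / ⟨ n ! ⟩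

  -- 2/(re^t + 1) · e^(xt); when ∣ r - 1 ∣ < 1 and p is odd, the constant
  -- coefficient r + 1 of the denominator is nonzero.
  eulerSeries : Carrier → Carrier → Series
  eulerSeries r x = const ⟨ 2 ⟩ ∗ recip (const r ∗ exp 1# ⊞ const 1#) ∗ exp x

  -- E[ n , r ] x is the value at x of the n-th r-Euler polynomial.
  E[_,_] : ℕ → Carrier → Carrier → Carrier
  E[ n , r ] x = ⟨ n ! ⟩ * eulerSeries r x n

{-# OPTIONS --safe #-}

-- Put Q = q eᵗ.  Substituting mt for t turns 2/(qᵐeᵗ + 1) · e^(xt) into
-- 2/(1 + Qᵐ) · e^(mxt), so each of the six expressions is n! times the n-th
-- coefficient of a power series.  For the first one the inner sum contributes
-- Σᵢ (-Q^(w₂w₃))ⁱ = (1 + Q^(w₁w₂w₃)) / (1 + Q^(w₂w₃)) because w₁ is odd, and the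
-- series becomes
--
--   4 e^(w₁w₂w₃(y₁ + y₂)t) (1 + Q^(w₁w₂w₃)) / ((1 + Q^(w₁w₂))(1 + Q^(w₁w₃))(1 + Q^(w₂w₃))),
--
-- which is symmetric in w₁, w₂, w₃.  The denominators are invertible: their
-- constant terms qᵐ + 1 are nonzero since ∣ qᵐ - 1 ∣ < 1 = ∣ 2 ∣ for odd p.

module Submission where

open import Defs
open import Algebra.Apartness.Bundles using (HeytingField)
open import Algebra.Bundles using (CommutativeRing)
open import Algebra.Morphism.Structures using (IsRingHomomorphism)
import Algebra.Properties.CommutativeSemiring.Binomial as Binomial
import Algebra.Properties.CommutativeSemiring.Exp as Exp
import Algebra.Properties.Ring as RingProps
import Algebra.Properties.Semiring.Mult as Mult
import Algebra.Properties.Semiring.Sum as Sum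
import Algebra.Solver.Ring.NaturalCoefficients.Default as SemiringSolver
open import Data.Empty using (⊥-elim)
open import Data.Fin.Base using (Fin; zero; suc; toℕ)
import Data.Fin.Properties as Fin
import Data.Integer.Base as ℤ
import Data.Integer.Properties as ℤ
open import Data.List.Base using (length; upTo)
open import Data.List.Properties using (filter-none)
import Data.List.Relation.Unary.All as All
open import Data.Nat.Base as ℕ using (ℕ; zero; suc; _∸_; _!; NonZero)
open import Data.Nat.Combinatorics using (_C_; nCk≡n!/k![n-k]!; k![n∸k]!∣n!)
import Data.Nat.DivMod as ℕ
open import Data.Nat.Divisibility using (_∣_; _∣?_; _∣0; ∣⇒≤; ∣-trans; ∣-refl; ∣m∣n⇒∣m+n; m∣m*n)
open import Data.Nat.Primality using (Prime; ¬prime[0]; ¬prime[1])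
import Data.Nat.Properties as ℕ
open import Data.Nat.Tactic.RingSolver using (solve-∀)
open import Data.Product.Base using (_×_; _,_; proj₁; proj₂)
open import Data.Rational.Base as ℚ using (ℚ; 0ℚ; 1ℚ)
import Data.Rational.Properties as ℚ
open import Data.Sum.Base using (inj₁; inj₂)
open import Data.Unit.Base using (⊤; tt)
open import Data.Vec.Base using (lookup)
import Relation.Binary.Construct.Add.Infimum.Strict ℚ._<_ as Strict
open import Relation.Binary.PropositionalEquality as ≡ using (_≡_; _≢_)
import Relation.Binary.Reasoning.Setoid as ≈-Reasoning
open import Relation.Nullary.Negation.Core using (¬_)

-- Alternating geometric sums with an odd number of terms

odd⇒nonZero : ∀ {n} → Odd n → NonZero n
odd⇒nonZero {zero}  odd = ⊥-elim (odd (2 ∣0))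
odd⇒nonZero {suc n} odd = _

module Geometric {c ℓ} (R : CommutativeRing c ℓ) where
  open CommutativeRing R
  open Exp commutativeSemiring using (_^_)
  open Sum semiring using (sum-syntax; sum-cong-≋; *-distribˡ-sum)
  open RingProps ring using (-1*x≈-x; -‿involutive)
  open SemiringSolver commutativeSemiring using (solve; _:=_; _:+_; _:*_; con)
  open ≈-Reasoning setoid

  private
    -- The variable `e` stands for `- 1#`. The identities hold in every commutative semiring; the
    -- relations `e * e ≈ 1#` and `x + e * x ≈ 0#` are applied separately.
    shift : ∀ e x s t → (e * (e * s)) * (x * (x * t)) ≈ (e * e) * ((x * x) * (s * t))
    shift = solve 4 (λ e x s t →
      (e :* (e :* s)) :* (x :* (x :* t)) := (e :* e) :* ((x :* x) :* (s :* t))) refl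

    expand : ∀ e x s → (1# + x) * (1# * 1# + (e * 1# * (x * 1#) + x * x * s))
                      ≈ (1# + x * x * ((1# + x) * s)) + ((x + e * x) + x * (e * x))
    expand = solve 3 (λ e x s →
      (con 1 :+ x) :* (con 1 :* con 1 :+ (e :* con 1 :* (x :* con 1) :+ x :* x :* s)) :=
      (con 1 :+ x :* x :* ((con 1 :+ x) :* s)) :+ ((x :+ e :* x) :+ x :* (e :* x))) refl

    collect : ∀ x y z → (1# + x * x * (1# + y)) + (0# + x * z) ≈ 1# + x * (x * y) + x * (x + z)
    collect = solve 3 (λ x y z →
      (con 1 :+ x :* x :* (con 1 :+ y)) :+ (con 0 :+ x :* z) :=
      con 1 :+ x :* (x :* y) :+ x :* (x :+ z)) refl

  alternatingSum : Carrier → ℕ → Carrier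
  alternatingSum x w = ∑[ i < w ] ((- 1#) ^ toℕ i * x ^ toℕ i)

  x+-1*x≈0 : ∀ x → x + - 1# * x ≈ 0#
  x+-1*x≈0 x = trans (+-congˡ (-1*x≈-x x)) (-‿inverseʳ x)

  -1*-1≈1 : - 1# * - 1# ≈ 1#
  -1*-1≈1 = trans (-1*x≈-x (- 1#)) (-‿involutive 1#)

  -- Induction in steps of two: the first two terms give (1 + x)(1 - x) = 1 - x², and the others
  -- give x² times the previous case, that is x²(1 + x^w). Parity rules out the empty sum.
  alternatingSum-odd : ∀ x w → Odd w → (1# + x) * alternatingSum x w ≈ 1# + x ^ w
  alternatingSum-odd x zero          odd = ⊥-elim (odd (2 ∣0))
  alternatingSum-odd x (suc zero)    odd = begin
    (1# + x) * (1# * 1# + 0#)  ≈⟨ *-congˡ (trans (+-identityʳ _) (*-identityʳ 1#)) ⟩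
    (1# + x) * 1#              ≈⟨ *-identityʳ _ ⟩
    1# + x                     ≈⟨ +-congˡ (*-identityʳ x) ⟨
    1# + x * 1#                ∎
  alternatingSum-odd x (suc (suc w)) odd = begin
    (1# + x) * alternatingSum x (suc (suc w))
      ≈⟨ *-congˡ (+-congˡ (+-congˡ tail²)) ⟩
    (1# + x) * (1# * 1# + (- 1# * 1# * (x * 1#) + x * x * alternatingSum x w))
      ≈⟨ expand (- 1#) x (alternatingSum x w) ⟩
    (1# + x * x * ((1# + x) * alternatingSum x w)) + ((x + - 1# * x) + x * (- 1# * x))
      ≈⟨ +-cong (+-congˡ (*-congˡ (alternatingSum-odd x w (λ 2∣w → odd (∣m∣n⇒∣m+n ∣-refl 2∣w)))))
                (+-congʳ (x+-1*x≈0 x)) ⟩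
    (1# + x * x * (1# + x ^ w)) + (0# + x * (- 1# * x))
      -- The x² from the induction hypothesis meets the -x² from the leading terms, and both cancel
      -- in `x * (x + - 1# * x)`.
      ≈⟨ collect x (x ^ w) (- 1# * x) ⟩
    1# + x * (x * x ^ w) + x * (x + - 1# * x)
      ≈⟨ +-congˡ (trans (*-congˡ (x+-1*x≈0 x)) (zeroʳ x)) ⟩
    1# + x * (x * x ^ w) + 0#
      ≈⟨ +-identityʳ _ ⟩
    1# + x ^ suc (suc w) ∎
    where
    tail² : ∑[ i < w ] ((- 1#) ^ suc (suc (toℕ i)) * x ^ suc (suc (toℕ i))) ≈ x * x * alternatingSum x w
    tail² = begin
      ∑[ i < w ] ((- 1#) ^ suc (suc (toℕ i)) * x ^ suc (suc (toℕ i)))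
        ≈⟨ sum-cong-≋ {n = w} (λ i → trans (shift (- 1#) x _ _) (trans (*-congʳ -1*-1≈1) (*-identityˡ _))) ⟩
      ∑[ i < w ] (x * x * ((- 1#) ^ toℕ i * x ^ toℕ i))
        ≈⟨ *-distribˡ-sum (x * x) (λ (i : Fin w) → (- 1#) ^ toℕ i * x ^ toℕ i) ⟨
      x * x * alternatingSum x w ∎

  private
    regroup : ∀ t m n d e s → (t * m * d) * (t * n * e * s) ≈ t * t * d * e * (m * n) * s
    regroup = solve 6 (λ t m n d e s →
      (t :* m :* d) :* (t :* n :* e :* s) := t :* t :* d :* e :* (m :* n) :* s) refl

    insert : ∀ u v z r s → u * v * ((z * r) * s) ≈ u * (z * s) * (v * r)
    insert = solve 5 (λ u v z r s → u :* v :* ((z :* r) :* s) := u :* (z :* s) :* (v :* r)) refl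

  -- Inserting `(1# + x) * r ≈ 1#` trades the sum for (1 + x^w) r, so that a third reciprocal `r`
  -- appears beside `m` and `n` and the three can be permuted.
  alternatingSum-product : ∀ t m n r d e x w → Odd w → (1# + x) * r ≈ 1# →
    (t * m * d) * (t * n * e * alternatingSum x w) ≈ t * t * d * e * (1# + x ^ w) * (m * n * r)
  alternatingSum-product t m n r d e x w odd inverse = begin
    (t * m * d) * (t * n * e * s)
      ≈⟨ regroup t m n d e s ⟩
    t * t * d * e * (m * n) * s
      ≈⟨ *-congˡ (trans (*-congʳ inverse) (*-identityˡ s)) ⟨
    t * t * d * e * (m * n) * (((1# + x) * r) * s)
      ≈⟨ insert (t * t * d * e) (m * n) (1# + x) r s ⟩
    t * t * d * e * ((1# + x) * s) * (m * n * r)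
      ≈⟨ *-congʳ (*-congˡ (alternatingSum-odd x w odd)) ⟩
    t * t * d * e * (1# + x ^ w) * (m * n * r) ∎
    where s = alternatingSum x w

-- Inverses in a field with an absolute value

module Inverse {c ℓ₁ ℓ₂} (K : ValuedField c ℓ₁ ℓ₂) where
  open ValuedField K

  private
    ∣∣-unitη : (x : ⊤ → Carrier) (u : ⊤) → ∣ x u ∣ ≡ ∣ x tt ∣
    ∣∣-unitη x u = ≡.refl

    -- x⁻¹ is go ∣ x ∣ refl with a local go : ∀ a → ∣ x ∣ ≡ a → Carrier.
    -- Abstracting ∣ x ∣ on both sides of refl would be ill-typed; the left-hand
    -- side is therefore written ∣ x u ∣, which equals ∣ x tt ∣ only by η for ⊤
    -- and so is left alone by the with-abstraction.
    inverseˡ′ : (x : ⊤ → Carrier) (u : ⊤) → ∣ x tt ∣ ≢ 𝟎 → x tt ⁻¹ * (x tt - 0#) ≈ 1#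
    inverseˡ′ x u ∣x∣≢𝟎 with ∣ x tt ∣ | ∣∣-unitη x u
    ... | 𝟎    | _ = ⊥-elim (∣x∣≢𝟎 ≡.refl)
    ... | p^ s | _ = proj₁ (proj₂ (#⇒invertible _))

  ⁻¹-inverseˡ : ∀ {x} → ∣ x ∣ ≢ 𝟎 → x ⁻¹ * x ≈ 1#
  ⁻¹-inverseˡ {x} ∣x∣≢𝟎 = trans (*-congˡ x≈x-0) (inverseˡ′ (λ _ → x) tt ∣x∣≢𝟎)
    where
    open RingProps (CommutativeRing.ring commutativeRing) using (-0#≈0#)
    x≈x-0 : x ≈ x - 0#
    x≈x-0 = sym (trans (+-congˡ -0#≈0#) (+-identityʳ x))

  ⁻¹-inverseʳ : ∀ {x} → ∣ x ∣ ≢ 𝟎 → x * x ⁻¹ ≈ 1#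
  ⁻¹-inverseʳ ∣x∣≢𝟎 = trans (*-comm _ _) (⁻¹-inverseˡ ∣x∣≢𝟎)

-- The commutative ring of formal power series

module PowerSeries {c ℓ₁ ℓ₂} (K : ValuedField c ℓ₁ ℓ₂) where
  open ValuedField K using (∣_∣; _⁻¹; commutativeRing)
  open CommutativeRing commutativeRing
  open Euler K
  open Inverse K
  open Exp commutativeSemiring using (_^_; ^-congˡ; ^-homo-*; ^-distrib-*)
  open Sum semiring using (sum-syntax; sum⁺-syntax; sum-cong-≋; *-distribˡ-sum; ∑-distrib-+; sum-replicate-zero)
  open RingProps ring using (-‿distribˡ-*; -1*x≈-x)
  open SemiringSolver commutativeSemiring using (solve; _:=_; _:+_; _:*_; con)
  open ≈-Reasoning setoid

  infix 4 _≋_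
  _≋_ : Series → Series → Set ℓ₁
  f ≋ g = ∀ n → f n ≈ g n

  -- `(f ∗ g) (suc n)` unfolds to `f 0 * g (suc n) + (tail f ∗ g) n`, the recursion behind the
  -- inductions on coefficients below.
  tail : Series → Series
  tail f n = f (suc n)

  ⊟_ : Series → Series
  (⊟ f) n = - f n

  ∗-cong : ∀ {f f′ g g′} → f ≋ f′ → g ≋ g′ → f ∗ g ≋ f′ ∗ g′
  ∗-cong f≋f′ g≋g′ n = sum-cong-≋ {n = suc n} (λ k → *-cong (f≋f′ (toℕ k)) (g≋g′ (n ∸ toℕ k)))

  ∗-distribʳ-⊞ : ∀ h f g → (f ⊞ g) ∗ h ≋ f ∗ h ⊞ g ∗ h
  ∗-distribʳ-⊞ h f g n = trans
    (sum-cong-≋ {n = suc n} (λ k → distribʳ (h (n ∸ toℕ k)) (f (toℕ k)) (g (toℕ k))))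
    (∑-distrib-+ {n = suc n} (λ k → f (toℕ k) * h (n ∸ toℕ k)) (λ k → g (toℕ k) * h (n ∸ toℕ k)))

  ∗-scaleˡ : ∀ a f g n → ((λ k → a * f k) ∗ g) n ≈ a * (f ∗ g) n
  ∗-scaleˡ a f g n = trans
    (sum-cong-≋ {n = suc n} (λ k → *-assoc a (f (toℕ k)) (g (n ∸ toℕ k))))
    (sym (*-distribˡ-sum {n = suc n} a (λ k → f (toℕ k) * g (n ∸ toℕ k))))

  -- The mirror image of the recursion at `tail`: the last term of the convolution is split off
  -- instead of the first. Comparing the two recursions gives commutativity.
  ∗-sucʳ : ∀ f g n → (f ∗ g) (suc n) ≈ (f ∗ tail g) n + f (suc n) * g 0
  ∗-sucʳ f g zero    = solve 2 (λ x y → x :+ (y :+ con 0) := (x :+ con 0) :+ y) refl _ _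
  ∗-sucʳ f g (suc n) = trans (+-congˡ (∗-sucʳ (tail f) g n)) (sym (+-assoc _ _ _))

  ∗-comm : ∀ f g → f ∗ g ≋ g ∗ f
  ∗-comm f g zero    = +-congʳ (*-comm _ _)
  ∗-comm f g (suc n) = begin
    f 0 * g (suc n) + (tail f ∗ g) n  ≈⟨ +-cong (*-comm _ _) (∗-comm (tail f) g n) ⟩
    g (suc n) * f 0 + (g ∗ tail f) n  ≈⟨ +-comm _ _ ⟩
    (g ∗ tail f) n + g (suc n) * f 0  ≈⟨ ∗-sucʳ g f n ⟨
    (g ∗ f) (suc n)                   ∎

  ∗-assoc : ∀ f g h → (f ∗ g) ∗ h ≋ f ∗ (g ∗ h)
  ∗-assoc f g h zero    = solve 3 (λ x y z →
    (x :* y :+ con 0) :* z :+ con 0 := x :* (y :* z :+ con 0) :+ con 0) refl _ _ _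
  ∗-assoc f g h (suc n) = begin
    -- By unfolding, the tail of `f ∗ g` is `f 0` times `tail g` plus `tail f ∗ g`; the induction
    -- hypothesis takes care of the second part.
    (f 0 * g 0 + 0#) * h (suc n) + (((λ k → f 0 * tail g k) ⊞ tail f ∗ g) ∗ h) n
      ≈⟨ +-congˡ (∗-distribʳ-⊞ h (λ k → f 0 * tail g k) (tail f ∗ g) n) ⟩
    (f 0 * g 0 + 0#) * h (suc n) + (((λ k → f 0 * tail g k) ∗ h) n + ((tail f ∗ g) ∗ h) n)
      ≈⟨ +-congˡ (+-cong (∗-scaleˡ (f 0) (tail g) h n) (∗-assoc (tail f) g h n)) ⟩
    (f 0 * g 0 + 0#) * h (suc n) + (f 0 * (tail g ∗ h) n + (tail f ∗ (g ∗ h)) n)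
      ≈⟨ solve 5 (λ x y z u v →
           (x :* y :+ con 0) :* z :+ (x :* u :+ v) := x :* (y :* z :+ u) :+ v) refl _ _ _ _ _ ⟩
    f 0 * (g 0 * h (suc n) + (tail g ∗ h) n) + (tail f ∗ (g ∗ h)) n ∎

  const-∗ : ∀ a f n → (const a ∗ f) n ≈ a * f n
  const-∗ a f zero    = +-identityʳ _
  const-∗ a f (suc n) = trans (+-congˡ (trans
    (sum-cong-≋ {n = suc n} (λ k → zeroˡ (f (n ∸ toℕ k)))) (sum-replicate-zero (suc n)))) (+-identityʳ _)

  ∗-identityˡ : ∀ f → const 1# ∗ f ≋ f
  ∗-identityˡ f n = trans (const-∗ 1# f n) (*-identityˡ _)

  seriesRing : CommutativeRing c ℓ₁
  seriesRing = record
    { Carrier = Series ; _≈_ = _≋_ ; _+_ = _⊞_ ; _*_ = _∗_ ; -_ = ⊟_ ; 0# = λ _ → 0# ; 1# = const 1#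
    ; isCommutativeRing = record
      { isRing = record
        { +-isAbelianGroup = record
          { isGroup = record
            { isMonoid = record
              { isSemigroup = record
                { isMagma = record
                  { isEquivalence = record
                    { refl = λ _ → refl ; sym = λ p n → sym (p n) ; trans = λ p q n → trans (p n) (q n) }
                  ; ∙-cong = λ p q n → +-cong (p n) (q n) }
                ; assoc = λ f g h n → +-assoc (f n) (g n) (h n) }
              ; identity = (λ f n → +-identityˡ (f n)) , (λ f n → +-identityʳ (f n)) }
            ; inverse = (λ f n → -‿inverseˡ (f n)) , (λ f n → -‿inverseʳ (f n))
            ; ⁻¹-cong = λ p n → -‿cong (p n) }
          ; comm = λ f g n → +-comm (f n) (g n) }
        ; *-cong = ∗-cong
        ; *-assoc = ∗-assoc
        ; *-identity = ∗-identityˡ , (λ f n → trans (∗-comm f (const 1#) n) (∗-identityˡ f n))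
        ; distrib = (λ f g h n → trans (∗-comm f (g ⊞ h) n) (trans (∗-distribʳ-⊞ f g h n)
                      (+-cong (∗-comm g f n) (∗-comm h f n))))
                  , ∗-distribʳ-⊞ }
      ; *-comm = ∗-comm } }

  -- The coefficients are stored in descending order. Reversing the index turns the sum in the
  -- recursion for 1/f into a convolution with `recip f`.
  lookup-recipCoeffs : ∀ f n (j : Fin (suc n)) → lookup (recipCoeffs f n) j ≡ recip f (n ∸ toℕ j)
  lookup-recipCoeffs f zero    zero    = ≡.refl
  lookup-recipCoeffs f (suc n) zero    = ≡.refl
  lookup-recipCoeffs f (suc n) (suc j) = lookup-recipCoeffs f n j

  -- The recursion sets the coefficient of the product at n + 1 to zero and solves for the newest
  -- coefficient of 1/f: its term is -s, and `s` is the rest of the convolution.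
  recip-inverse : ∀ {f} → ∣ f 0 ∣ ≢ 𝟎 → f ∗ recip f ≋ const 1#
  recip-inverse {f} ∣f₀∣≢𝟎 zero    = trans (+-identityʳ _) (⁻¹-inverseʳ ∣f₀∣≢𝟎)
  recip-inverse {f} ∣f₀∣≢𝟎 (suc n) = begin
    f 0 * (- (f 0 ⁻¹) * s) + (tail f ∗ recip f) n
      ≈⟨ +-cong (trans (sym (*-assoc _ _ _)) (*-congʳ (*-comm _ _)))
                (sum-cong-≋ {n = suc n} (λ j → *-congˡ {x = f (suc (toℕ j))} (reflexive (≡.sym (lookup-recipCoeffs f n j))))) ⟩
    - (f 0 ⁻¹) * f 0 * s + s
      ≈⟨ +-congʳ (*-congʳ (trans (sym (-‿distribˡ-* _ _)) (-‿cong (⁻¹-inverseˡ ∣f₀∣≢𝟎)))) ⟩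
    - 1# * s + s
      ≈⟨ +-congʳ (-1*x≈-x s) ⟩
    - s + s
      ≈⟨ -‿inverseˡ s ⟩
    0# ∎
    where s = ∑[ j ≤ n ] (f (suc (toℕ j)) * lookup (recipCoeffs f n) j)

  -- Substitution of mt for t. The lemmas below say that it respects products, fixes constants and
  -- takes e^(xt) to e^(mxt).
  scale : Carrier → Series → Series
  scale m f n = m ^ n * f n

  ^-split : ∀ m {n} (k : Fin (suc n)) → m ^ n ≈ m ^ toℕ k * m ^ (n ∸ toℕ k)
  ^-split m {n} k = trans (reflexive (≡.cong (m ^_) (≡.sym (ℕ.m+[n∸m]≡n (Fin.toℕ≤pred[n] k)))))
                          (^-homo-* m (toℕ k) (n ∸ toℕ k))

  scale-∗ : ∀ m f g → scale m (f ∗ g) ≋ scale m f ∗ scale m g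
  scale-∗ m f g n = trans
    (*-distribˡ-sum {n = suc n} (m ^ n) (λ k → f (toℕ k) * g (n ∸ toℕ k)))
    (sum-cong-≋ {n = suc n} (λ k → trans (*-congʳ (^-split m k))
      (solve 4 (λ a b x y → a :* b :* (x :* y) := a :* x :* (b :* y)) refl _ _ (f (toℕ k)) (g (n ∸ toℕ k)))))

  scale-const : ∀ m a → scale m (const a) ≋ const a
  scale-const m a zero    = *-identityˡ a
  scale-const m a (suc n) = zeroʳ _

  scale-exp : ∀ m x → scale m (exp x) ≋ exp (m * x)
  scale-exp m x n = trans (sym (*-assoc _ _ _)) (*-congʳ (sym (^-distrib-* m x n)))

  exp-cong : ∀ {x y} → x ≈ y → exp x ≋ exp y
  exp-cong x≈y n = *-congʳ (^-congˡ n x≈y)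

  const-* : ∀ a b → const (a * b) ≋ const a ∗ const b
  const-* a b zero    = sym (const-∗ a (const b) 0)
  const-* a b (suc n) = sym (trans (const-∗ a (const b) (suc n)) (zeroʳ a))

  module S = CommutativeRing seriesRing
  open Sum S.semiring using () renaming (sum to sumˢ)

  sumˢ-coeff : ∀ {w} (f : Fin w → Series) n → sumˢ f n ≈ ∑[ i < w ] f i n
  sumˢ-coeff {zero}  f n = refl
  sumˢ-coeff {suc w} f n = +-congˡ (sumˢ-coeff (λ i → f (suc i)) n)

-- Exponential series and binomial convolution

nCk*k!*[n∸k]!≡n! : ∀ {n k} → k ℕ.≤ n → (n C k) ℕ.* (k ! ℕ.* (n ∸ k) !) ≡ n !
nCk*k!*[n∸k]!≡n! {n} {k} k≤n =
  ≡.trans (≡.cong (ℕ._* (k ! ℕ.* (n ∸ k) !)) (nCk≡n!/k![n-k]! k≤n)) (ℕ.m/n*n≡m (k![n∸k]!∣n! k≤n))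
  where instance _ = k ℕ.!* (n ∸ k) !≢0

module Exponential {c ℓ₁ ℓ₂} (K : ValuedField c ℓ₁ ℓ₂)
  (⟨⟩≢0 : ∀ n → .{{NonZero n}} → ValuedField.∣_∣ K (ValuedField.⟨_⟩ K n) ≢ 𝟎) where
  open ValuedField K using (⟨_⟩; _⁻¹; commutativeRing)
  open CommutativeRing commutativeRing
  open Euler K
  open Inverse K
  open PowerSeries K
  open Exp commutativeSemiring using (_^_)
  open Sum semiring using (sum⁺-syntax; sum-cong-≋; *-distribˡ-sum)
  open Mult semiring using (×1-homo-*; ×-assoc-*; ×-congʳ) renaming (_×_ to _⋆_)
  open SemiringSolver commutativeSemiring using (solve; _:=_; _:*_)
  open ≈-Reasoning setoid using (begin_; step-≈-⟩; _∎)
  private module S^ = Exp S.commutativeSemiring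

  n!⁻¹-inverse : ∀ n → ⟨ n ! ⟩ ⁻¹ * ⟨ n ! ⟩ ≈ 1#
  n!⁻¹-inverse n = ⁻¹-inverseˡ (⟨⟩≢0 (n !))
    where instance _ = n ℕ.!≢0

  n!-cancelˡ : ∀ n {x y} → ⟨ n ! ⟩ * x ≈ ⟨ n ! ⟩ * y → x ≈ y
  n!-cancelˡ n {x} {y} eq = begin
    x                           ≈⟨ sym (*-identityˡ x) ⟩
    1# * x                      ≈⟨ sym (*-congʳ (n!⁻¹-inverse n)) ⟩
    ⟨ n ! ⟩ ⁻¹ * ⟨ n ! ⟩ * x    ≈⟨ *-assoc _ _ _ ⟩
    ⟨ n ! ⟩ ⁻¹ * (⟨ n ! ⟩ * x)  ≈⟨ *-congˡ eq ⟩
    ⟨ n ! ⟩ ⁻¹ * (⟨ n ! ⟩ * y)  ≈⟨ sym (*-assoc _ _ _) ⟩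
    ⟨ n ! ⟩ ⁻¹ * ⟨ n ! ⟩ * y    ≈⟨ *-congʳ (n!⁻¹-inverse n) ⟩
    1# * y                      ≈⟨ *-identityˡ y ⟩
    y                           ∎

  -- Measured against tⁿ/n!, coefficients multiply by binomial convolution, since n! = C(n,k) k!
  -- (n-k)!. This is the source of the binomial sums in the theorem.
  n!*∗ : ∀ f g n → ⟨ n ! ⟩ * (f ∗ g) n ≈
    ∑[ k ≤ n ] (⟨ n C toℕ k ⟩ * (⟨ toℕ k ! ⟩ * f (toℕ k)) * (⟨ (n ∸ toℕ k) ! ⟩ * g (n ∸ toℕ k)))
  n!*∗ f g n = trans
    (*-distribˡ-sum {n = suc n} ⟨ n ! ⟩ (λ k → f (toℕ k) * g (n ∸ toℕ k)))
    (sum-cong-≋ {n = suc n} (λ k → trans (*-congʳ (n!-split k))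
      (solve 5 (λ a b d x y → a :* (b :* d) :* (x :* y) := a :* (b :* x) :* (d :* y)) refl
        _ _ _ (f (toℕ k)) (g (n ∸ toℕ k)))))
    where
    n!-split : ∀ (k : Fin (suc n)) → ⟨ n ! ⟩ ≈ ⟨ n C toℕ k ⟩ * (⟨ toℕ k ! ⟩ * ⟨ (n ∸ toℕ k) ! ⟩)
    n!-split k = trans
      (reflexive (≡.cong ⟨_⟩ (≡.sym (nCk*k!*[n∸k]!≡n! (Fin.toℕ≤pred[n] k)))))
      (trans (×1-homo-* (n C toℕ k) (toℕ k ! ℕ.* (n ∸ toℕ k) !))
             (*-congˡ (×1-homo-* (toℕ k !) ((n ∸ toℕ k) !))))

  n!*exp : ∀ x n → ⟨ n ! ⟩ * exp x n ≈ x ^ n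
  n!*exp x n = trans
    (solve 3 (λ a b d → a :* (b :* d) := d :* a :* b) refl _ _ _)
    (trans (*-congʳ (n!⁻¹-inverse n)) (*-identityˡ _))

  -- After multiplication by n!, which is invertible, the coefficients are compared by the binomial
  -- theorem.
  exp-+ : ∀ x y → exp (x + y) ≋ exp x ∗ exp y
  exp-+ x y n = n!-cancelˡ n (begin
    ⟨ n ! ⟩ * exp (x + y) n
      ≈⟨ n!*exp (x + y) n ⟩
    (x + y) ^ n
      ≈⟨ Binomial.theorem commutativeSemiring n x y ⟩
    ∑[ k ≤ n ] ((n C toℕ k) ⋆ (x ^ toℕ k * y ^ (n ∸ toℕ k)))
      ≈⟨ sum-cong-≋ {n = suc n} (λ k → sym (term k)) ⟩
    ∑[ k ≤ n ] (⟨ n C toℕ k ⟩ * (⟨ toℕ k ! ⟩ * exp x (toℕ k)) * (⟨ (n ∸ toℕ k) ! ⟩ * exp y (n ∸ toℕ k)))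
      ≈⟨ sym (n!*∗ (exp x) (exp y) n) ⟩
    ⟨ n ! ⟩ * (exp x ∗ exp y) n ∎)
    where
    term : ∀ (k : Fin (suc n)) →
      ⟨ n C toℕ k ⟩ * (⟨ toℕ k ! ⟩ * exp x (toℕ k)) * (⟨ (n ∸ toℕ k) ! ⟩ * exp y (n ∸ toℕ k)) ≈
      (n C toℕ k) ⋆ (x ^ toℕ k * y ^ (n ∸ toℕ k))
    term k = trans
      (*-cong (*-congˡ (n!*exp x (toℕ k))) (n!*exp y (n ∸ toℕ k)))
      (trans (*-assoc _ _ _) (trans (×-assoc-* (n C toℕ k) 1# _) (×-congʳ (n C toℕ k) (*-identityˡ _))))

  exp-0 : exp 0# ≋ const 1#
  exp-0 zero    = trans (*-congʳ (sym (+-identityʳ 1#))) (⁻¹-inverseʳ (⟨⟩≢0 1))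
  exp-0 (suc n) = trans (*-congʳ (zeroˡ _)) (zeroˡ _)

  exp-⟨⟩ : ∀ m → exp ⟨ m ⟩ ≋ exp 1# S^.^ m
  exp-⟨⟩ zero    = exp-0
  exp-⟨⟩ (suc m) = S.trans (exp-+ 1# ⟨ m ⟩) (S.*-congˡ {x = exp 1#} (exp-⟨⟩ m))

  const-^ : ∀ a m → const (a ^ m) ≋ const a S^.^ m
  const-^ a zero    = S.refl
  const-^ a (suc m) = S.trans (const-* a (a ^ m)) (S.*-congˡ {x = const a} (const-^ a m))

-- The six expressions as coefficients of one symmetric series

module EulerSymmetry {c ℓ₁ ℓ₂} (K : ValuedField c ℓ₁ ℓ₂)
  (⟨⟩≢0 : ∀ n → .{{NonZero n}} → ValuedField.∣_∣ K (ValuedField.⟨_⟩ K n) ≢ 𝟎)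
  (q : ValuedField.Carrier K)
  (∣qᵐ+1∣≢𝟎 : ∀ m → ValuedField.∣_∣ K (ValuedField._+_ K (ValuedField._^_ K q m) (ValuedField.1# K)) ≢ 𝟎) where
  open ValuedField K using (∣_∣; ∣∣-cong; ⟨_⟩; _⁻¹; _/_; commutativeRing)
  open CommutativeRing commutativeRing
  open Euler K
  open Inverse K
  open PowerSeries K
  open Exponential K ⟨⟩≢0
  open Exp commutativeSemiring using (_^_; ^-congˡ; ^-distrib-*)
  open Sum semiring using (sum-syntax; sum⁺-syntax; sum-cong-≋; *-distribˡ-sum)
  open Mult semiring using (×1-homo-*)
  open SemiringSolver commutativeSemiring using (solve; _:=_; _:+_; _:*_)
  open Geometric seriesRing using (alternatingSum; alternatingSum-product)
  open Exp S.commutativeSemiring using () renaming (_^_ to _^ˢ_)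
  private
    module S^ = Exp S.commutativeSemiring
    module SΣ = Sum S.semiring
    module Sol = SemiringSolver S.commutativeSemiring
  open ≈-Reasoning setoid using (begin_; step-≈-⟩; _∎)

  Q : Series
  Q = const q ∗ exp 1#

  Q^ : ∀ m → const (q ^ m) ∗ exp ⟨ m ⟩ ≋ Q ^ˢ m
  Q^ m = S.trans (∗-cong (const-^ q m) (exp-⟨⟩ m)) (S.sym (S^.^-distrib-* (const q) (exp 1#) m))

  denominator : Carrier → Series
  denominator r = const r ∗ exp 1# ⊞ const 1#

  scale-denominator : ∀ m → scale ⟨ m ⟩ (denominator (q ^ m)) ≋ const 1# ⊞ Q ^ˢ m
  scale-denominator m n = begin
    scale ⟨ m ⟩ (denominator (q ^ m)) n
      ≈⟨ distribˡ _ _ _ ⟩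
    scale ⟨ m ⟩ (const (q ^ m) ∗ exp 1#) n + scale ⟨ m ⟩ (const 1#) n
      ≈⟨ +-cong (scale-∗ ⟨ m ⟩ (const (q ^ m)) (exp 1#) n) (scale-const ⟨ m ⟩ 1# n) ⟩
    (scale ⟨ m ⟩ (const (q ^ m)) ∗ scale ⟨ m ⟩ (exp 1#)) n + const 1# n
      ≈⟨ +-congʳ (∗-cong (scale-const ⟨ m ⟩ (q ^ m))
           (S.trans (scale-exp ⟨ m ⟩ 1#) (exp-cong (*-identityʳ ⟨ m ⟩))) n) ⟩
    (const (q ^ m) ∗ exp ⟨ m ⟩) n + const 1# n
      ≈⟨ trans (+-congʳ (Q^ m n)) (+-comm _ _) ⟩
    const 1# n + (Q ^ˢ m) n ∎

  -- The series 1/(1 + Qᵐ), encoded as 1/(qᵐeᵗ + 1) with mt substituted for t, the form in which it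
  -- occurs in the scaled Euler series.
  R : ℕ → Series
  R m = scale ⟨ m ⟩ (recip (denominator (q ^ m)))

  -- Since `scale` is multiplicative and fixes 1, it carries the inverse relation along. The
  -- constant term of the denominator is qᵐ + 1, nonzero by assumption.
  R-inverse : ∀ m → (const 1# ⊞ Q ^ˢ m) ∗ R m ≋ const 1#
  R-inverse m n = begin
    ((const 1# ⊞ Q ^ˢ m) ∗ R m) n
      ≈⟨ sym (∗-cong {g = R m} (scale-denominator m) S.refl n) ⟩
    (scale ⟨ m ⟩ f ∗ scale ⟨ m ⟩ (recip f)) n
      ≈⟨ sym (scale-∗ ⟨ m ⟩ f (recip f) n) ⟩
    scale ⟨ m ⟩ (f ∗ recip f) n
      ≈⟨ *-congˡ (recip-inverse f₀≢0 n) ⟩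
    scale ⟨ m ⟩ (const 1#) n
      ≈⟨ scale-const ⟨ m ⟩ 1# n ⟩
    const 1# n ∎
    where
    f = denominator (q ^ m)
    f₀≈ : f 0 ≈ q ^ m + 1#
    f₀≈ = +-congʳ (trans (const-∗ (q ^ m) (exp 1#) 0)
      (trans (*-congˡ (exp-0 0)) (*-identityʳ _)))
    f₀≢0 : ∣ f 0 ∣ ≢ 𝟎
    f₀≢0 eq = ∣qᵐ+1∣≢𝟎 m (≡.trans (≡.sym (∣∣-cong f₀≈)) eq)

  scale-eulerSeries : ∀ m x → scale ⟨ m ⟩ (eulerSeries (q ^ m) x) ≋ const ⟨ 2 ⟩ ∗ R m ∗ exp (⟨ m ⟩ * x)
  scale-eulerSeries m x = S.trans (scale-∗ ⟨ m ⟩ (const ⟨ 2 ⟩ ∗ r) (exp x))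
    (∗-cong (S.trans (scale-∗ ⟨ m ⟩ (const ⟨ 2 ⟩) r) (∗-cong {g = R m} (scale-const ⟨ m ⟩ ⟨ 2 ⟩) S.refl))
            (scale-exp ⟨ m ⟩ x))
    where r = recip (denominator (q ^ m))

  const--1 : const (- 1#) ≋ S.- (const 1#)
  const--1 zero    = refl
  const--1 (suc n) = sym (RingProps.-0#≈0# ring)

  -- The generating series of the inner sums: n! times its n-th coefficient is Nⁿ times the inner
  -- sum with Euler polynomials of index n.
  innerSeries : (a b N P : ℕ) → Carrier → Series
  innerSeries a b N P y n = ∑[ i < a ] ((- 1#) ^ toℕ i * q ^ (P ℕ.* toℕ i)
    * scale ⟨ N ⟩ (eulerSeries (q ^ N) (⟨ b ⟩ * y + ⟨ b ⟩ / ⟨ a ⟩ * ⟨ toℕ i ⟩)) n)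

  -- The factor a of ac cancels the denominator of b/a and leaves the integral shift bci.
  -- Integrality allows e^(bci t) to join q^(bci) in the power Q^(bci).
  shift-argument : ∀ a b c i y → .{{NonZero a}} →
    ⟨ a ℕ.* c ⟩ * (⟨ b ⟩ * y + ⟨ b ⟩ / ⟨ a ⟩ * ⟨ i ⟩) ≈ ⟨ a ℕ.* b ℕ.* c ⟩ * y + ⟨ b ℕ.* c ℕ.* i ⟩
  shift-argument a b c i y = begin
    ⟨ a ℕ.* c ⟩ * (⟨ b ⟩ * y + ⟨ b ⟩ / ⟨ a ⟩ * ⟨ i ⟩)
      ≈⟨ *-congʳ (×1-homo-* a c) ⟩
    ⟨ a ⟩ * ⟨ c ⟩ * (⟨ b ⟩ * y + ⟨ b ⟩ * ⟨ a ⟩ ⁻¹ * ⟨ i ⟩)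
      ≈⟨ solve 6 (λ a c b y a⁻¹ i → a :* c :* (b :* y :+ b :* a⁻¹ :* i)
           := a :* b :* c :* y :+ (a⁻¹ :* a) :* (b :* c :* i)) refl _ _ _ _ _ _ ⟩
    ⟨ a ⟩ * ⟨ b ⟩ * ⟨ c ⟩ * y + (⟨ a ⟩ ⁻¹ * ⟨ a ⟩) * (⟨ b ⟩ * ⟨ c ⟩ * ⟨ i ⟩)
      ≈⟨ +-congˡ (trans (*-congʳ (⁻¹-inverseˡ (⟨⟩≢0 a))) (*-identityˡ _)) ⟩
    ⟨ a ⟩ * ⟨ b ⟩ * ⟨ c ⟩ * y + ⟨ b ⟩ * ⟨ c ⟩ * ⟨ i ⟩
      ≈⟨ sym (+-cong (*-congʳ (⟨⟩-product a b c)) (⟨⟩-product b c i)) ⟩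
    ⟨ a ℕ.* b ℕ.* c ⟩ * y + ⟨ b ℕ.* c ℕ.* i ⟩ ∎
    where
    ⟨⟩-product : ∀ k l m → ⟨ k ℕ.* l ℕ.* m ⟩ ≈ ⟨ k ⟩ * ⟨ l ⟩ * ⟨ m ⟩
    ⟨⟩-product k l m = trans (×1-homo-* (k ℕ.* l) m) (*-congʳ (×1-homo-* k l))

  -- The shift by i leaves each Euler series as a factor e^(bci t). With the coefficient (-1)^i
  -- q^(bci) it forms the i-th term of the alternating sum in Q^(bc), and what remains is
  -- independent of i.
  innerSeries≋ : ∀ a b c y → .{{NonZero a}} →
    innerSeries a b (a ℕ.* c) (b ℕ.* c) y ≋
    const ⟨ 2 ⟩ ∗ R (a ℕ.* c) ∗ exp (⟨ a ℕ.* b ℕ.* c ⟩ * y) ∗ alternatingSum (Q ^ˢ (b ℕ.* c)) a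
  innerSeries≋ a b c y n = begin
    innerSeries a b N P y n
      ≈⟨ sum-cong-≋ {n = a} term ⟩
    ∑[ i < a ] (G ∗ h i) n
      ≈⟨ sym (sumˢ-coeff {a} (λ i → G ∗ h i) n) ⟩
    SΣ.sum {a} (λ i → G ∗ h i) n
      ≈⟨ sym (SΣ.*-distribˡ-sum {a} G h n) ⟩
    (G ∗ alternatingSum (Q ^ˢ P) a) n ∎
    where
    N = a ℕ.* c
    P = b ℕ.* c
    T = a ℕ.* b ℕ.* c
    G₀ = const ⟨ 2 ⟩ ∗ R N
    G = G₀ ∗ exp (⟨ T ⟩ * y)
    h : Fin a → Series
    h i = (S.- const 1#) ^ˢ toℕ i ∗ (Q ^ˢ P) ^ˢ toℕ i

    module _ (i : Fin a) where
      s = (- 1#) ^ toℕ i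
      t = q ^ (P ℕ.* toℕ i)
      x = ⟨ b ⟩ * y + ⟨ b ⟩ / ⟨ a ⟩ * ⟨ toℕ i ⟩
      e = exp (⟨ P ℕ.* toℕ i ⟩)

      exp-split : exp (⟨ N ⟩ * x) ≋ exp (⟨ T ⟩ * y) ∗ e
      exp-split = S.trans (exp-cong (shift-argument a b c (toℕ i) y)) (exp-+ (⟨ T ⟩ * y) ⟨ P ℕ.* toℕ i ⟩)

      s≋ : const s ≋ (S.- const 1#) ^ˢ toℕ i
      s≋ = S.trans (const-^ (- 1#) (toℕ i)) (S^.^-congˡ (toℕ i) const--1)

      te≋ : const t ∗ e ≋ (Q ^ˢ P) ^ˢ toℕ i
      te≋ = S.trans (Q^ (P ℕ.* toℕ i)) (S.sym (S^.^-assocʳ Q P (toℕ i)))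

      rearrange : ∀ s t g u e → s S.* (t S.* (g S.* (u S.* e))) S.≈ g S.* u S.* (s S.* (t S.* e))
      rearrange = Sol.solve 5 (λ s t g u e → s Sol.:* (t Sol.:* (g Sol.:* (u Sol.:* e)))
        Sol.:= g Sol.:* u Sol.:* (s Sol.:* (t Sol.:* e))) S.refl

      term : s * t * scale ⟨ N ⟩ (eulerSeries (q ^ N) x) n ≈ (G ∗ h i) n
      term = begin
        s * t * scale ⟨ N ⟩ (eulerSeries (q ^ N) x) n
          ≈⟨ *-congˡ (scale-eulerSeries N x n) ⟩
        s * t * (G₀ ∗ exp (⟨ N ⟩ * x)) n
          ≈⟨ *-congˡ (∗-cong {f = G₀} S.refl exp-split n) ⟩
        s * t * (G₀ ∗ (exp (⟨ T ⟩ * y) ∗ e)) n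
          ≈⟨ *-assoc _ _ _ ⟩
        s * (t * (G₀ ∗ (exp (⟨ T ⟩ * y) ∗ e)) n)
          -- The scalars become constant series, so that the rearrangement takes place in the ring
          -- of series.
          ≈⟨ sym (*-congˡ (const-∗ t (G₀ ∗ (exp (⟨ T ⟩ * y) ∗ e)) n)) ⟩
        s * (const t ∗ (G₀ ∗ (exp (⟨ T ⟩ * y) ∗ e))) n
          ≈⟨ sym (const-∗ s (const t ∗ (G₀ ∗ (exp (⟨ T ⟩ * y) ∗ e))) n) ⟩
        (const s ∗ (const t ∗ (G₀ ∗ (exp (⟨ T ⟩ * y) ∗ e)))) n
          ≈⟨ rearrange (const s) (const t) G₀ (exp (⟨ T ⟩ * y)) e n ⟩
        (G ∗ (const s ∗ (const t ∗ e))) n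
          ≈⟨ ∗-cong {f = G} S.refl (∗-cong s≋ te≋) n ⟩
        (G ∗ h i) n ∎

  -- The common shape of the six expressions: (a , b , c) is a permutation of
  -- (w₁ , w₂ , w₃) and M, N, P stand for ab, ac, bc.
  line : (a b c M N P n : ℕ) (y₁ y₂ : Carrier) → Carrier
  line a b c M N P n y₁ y₂ = ⟨ a ⟩ ^ n * ∑[ k ≤ n ]
    ( ⟨ n C toℕ k ⟩ * E[ toℕ k , q ^ M ] (⟨ c ⟩ * y₁)
    * ⟨ c ⟩ ^ (n ∸ toℕ k) * ⟨ b ⟩ ^ toℕ k
    * ∑[ i < a ] ( (- 1#) ^ toℕ i * q ^ (P ℕ.* toℕ i)
      * E[ n ∸ toℕ k , q ^ N ] (⟨ b ⟩ * y₂ + ⟨ b ⟩ / ⟨ a ⟩ * ⟨ toℕ i ⟩)))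

  -- In the use below, `x` is a power of N that goes inside the sum to complete `scale`, and `y` is
  -- the factorial that comes out of every Euler value.
  ∑-exchange : ∀ {w} x y (u v : Fin w → Carrier) →
    x * ∑[ i < w ] (u i * (y * v i)) ≈ y * ∑[ i < w ] (u i * (x * v i))
  ∑-exchange {w} x y u v = begin
    x * ∑[ i < w ] (u i * (y * v i))
      ≈⟨ *-distribˡ-sum x (λ i → u i * (y * v i)) ⟩
    ∑[ i < w ] (x * (u i * (y * v i)))
      ≈⟨ sum-cong-≋ {n = w} (λ i → solve 4 (λ x y u v → x :* (u :* (y :* v)) := y :* (u :* (x :* v))) refl x y (u i) (v i)) ⟩
    ∑[ i < w ] (y * (u i * (x * v i)))
      ≈⟨ sym (*-distribˡ-sum y (λ i → u i * (x * v i))) ⟩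
    y * ∑[ i < w ] (u i * (x * v i)) ∎

  -- Split aⁿ as a^k a^(n-k). The first part joins b^k to (ab)^k, the second joins c^(n-k) to
  -- (ac)^(n-k), and these are the powers that `scale` by ab and by ac produces. What remains is a
  -- binomial convolution.
  line≈product : ∀ a b c P n y₁ y₂ → line a b c (a ℕ.* b) (a ℕ.* c) P n y₁ y₂ ≈
    ⟨ n ! ⟩ * (scale ⟨ a ℕ.* b ⟩ (eulerSeries (q ^ (a ℕ.* b)) (⟨ c ⟩ * y₁)) ∗ innerSeries a b (a ℕ.* c) P y₂) n
  line≈product a b c P n y₁ y₂ = begin
    line a b c M N P n y₁ y₂
      ≈⟨ *-distribˡ-sum {n = suc n} (⟨ a ⟩ ^ n) summand ⟩
    ∑[ k ≤ n ] (⟨ a ⟩ ^ n * summand k)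
      ≈⟨ sum-cong-≋ {n = suc n} term ⟩
    ∑[ k ≤ n ] (⟨ n C toℕ k ⟩ * (⟨ toℕ k ! ⟩ * scale ⟨ M ⟩ f (toℕ k))
      * (⟨ (n ∸ toℕ k) ! ⟩ * innerSeries a b N P y₂ (n ∸ toℕ k)))
      ≈⟨ sym (n!*∗ (scale ⟨ M ⟩ f) (innerSeries a b N P y₂) n) ⟩
    ⟨ n ! ⟩ * (scale ⟨ M ⟩ f ∗ innerSeries a b N P y₂) n ∎
    where
    M = a ℕ.* b
    N = a ℕ.* c
    f = eulerSeries (q ^ M) (⟨ c ⟩ * y₁)
    u : Fin a → Carrier
    u i = (- 1#) ^ toℕ i * q ^ (P ℕ.* toℕ i)
    g : Fin a → Series
    g i = eulerSeries (q ^ N) (⟨ b ⟩ * y₂ + ⟨ b ⟩ / ⟨ a ⟩ * ⟨ toℕ i ⟩)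

    summand : Fin (suc n) → Carrier
    summand k = ⟨ n C toℕ k ⟩ * (⟨ toℕ k ! ⟩ * f (toℕ k)) * ⟨ c ⟩ ^ (n ∸ toℕ k) * ⟨ b ⟩ ^ toℕ k
      * ∑[ i < a ] (u i * (⟨ (n ∸ toℕ k) ! ⟩ * g i (n ∸ toℕ k)))

    ⟨⟩^-product : ∀ k l m → ⟨ k ⟩ ^ m * ⟨ l ⟩ ^ m ≈ ⟨ k ℕ.* l ⟩ ^ m
    ⟨⟩^-product k l m = trans (sym (^-distrib-* ⟨ k ⟩ ⟨ l ⟩ m)) (^-congˡ m (sym (×1-homo-* k l)))

    module _ (k : Fin (suc n)) where
      j = n ∸ toℕ k
      W = ∑[ i < a ] (u i * (⟨ j ! ⟩ * g i j))

      term : ⟨ a ⟩ ^ n * summand k ≈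
             ⟨ n C toℕ k ⟩ * (⟨ toℕ k ! ⟩ * scale ⟨ M ⟩ f (toℕ k)) * (⟨ j ! ⟩ * innerSeries a b N P y₂ j)
      term = begin
        ⟨ a ⟩ ^ n * summand k
          ≈⟨ *-congʳ (^-split ⟨ a ⟩ k) ⟩
        ⟨ a ⟩ ^ toℕ k * ⟨ a ⟩ ^ j * summand k
          ≈⟨ solve 8 (λ aᵏ aʲ C k! f cʲ bᵏ W → aᵏ :* aʲ :* (C :* (k! :* f) :* cʲ :* bᵏ :* W)
               := C :* (k! :* (aᵏ :* bᵏ :* f)) :* (aʲ :* cʲ :* W)) refl _ _ _ _ (f (toℕ k)) _ _ W ⟩
        ⟨ n C toℕ k ⟩ * (⟨ toℕ k ! ⟩ * (⟨ a ⟩ ^ toℕ k * ⟨ b ⟩ ^ toℕ k * f (toℕ k))) * (⟨ a ⟩ ^ j * ⟨ c ⟩ ^ j * W)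
          ≈⟨ *-cong (*-congˡ (*-congˡ (*-congʳ (⟨⟩^-product a b (toℕ k))))) (*-congʳ (⟨⟩^-product a c j)) ⟩
        ⟨ n C toℕ k ⟩ * (⟨ toℕ k ! ⟩ * scale ⟨ M ⟩ f (toℕ k)) * (⟨ N ⟩ ^ j * W)
          ≈⟨ *-congˡ (∑-exchange (⟨ N ⟩ ^ j) ⟨ j ! ⟩ u (λ i → g i j)) ⟩
        ⟨ n C toℕ k ⟩ * (⟨ toℕ k ! ⟩ * scale ⟨ M ⟩ f (toℕ k)) * (⟨ j ! ⟩ * innerSeries a b N P y₂ j) ∎

  numerator : (T : ℕ) (y₁ y₂ : Carrier) → Series
  numerator T y₁ y₂ = const ⟨ 2 ⟩ ∗ const ⟨ 2 ⟩ ∗ exp (⟨ T ⟩ * y₁) ∗ exp (⟨ T ⟩ * y₂) ∗ (const 1# ⊞ Q ^ˢ T)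

  symmetricSeries : (M N P T : ℕ) (y₁ y₂ : Carrier) → Series
  symmetricSeries M N P T y₁ y₂ = numerator T y₁ y₂ ∗ (R M ∗ R N ∗ R P)

  -- The products are tied to `a`, `b`, `c` by equations, so that one fixed choice of pairwise
  -- products and of `T` serves all permutations, whatever the order of the factors.
  line≈symmetricSeries : ∀ {a b c M N P T} → Odd a →
    M ≡ a ℕ.* b → N ≡ a ℕ.* c → P ≡ b ℕ.* c → T ≡ a ℕ.* b ℕ.* c → ∀ n y₁ y₂ →
    line a b c M N P n y₁ y₂ ≈ ⟨ n ! ⟩ * symmetricSeries M N P T y₁ y₂ n
  line≈symmetricSeries {a} {b} {c} odd ≡.refl ≡.refl ≡.refl ≡.refl n y₁ y₂ =
    trans (line≈product a b c P n y₁ y₂) (*-congˡ (begin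
    (scale ⟨ M ⟩ (eulerSeries (q ^ M) (⟨ c ⟩ * y₁)) ∗ innerSeries a b N P y₂) n
      -- Scaling by ab takes the argument cy₁ to Ty₁, alongside the Ty₂ of the inner series.
      ≈⟨ ∗-cong (S.trans (scale-eulerSeries M (⟨ c ⟩ * y₁)) (∗-cong {f = const ⟨ 2 ⟩ ∗ R M} S.refl
           (exp-cong (trans (sym (*-assoc _ _ _)) (*-congʳ (sym (×1-homo-* M c)))))))
           (innerSeries≋ a b c y₂ {{odd⇒nonZero odd}}) n ⟩
    (const ⟨ 2 ⟩ ∗ R M ∗ exp (⟨ T ⟩ * y₁) ∗
      (const ⟨ 2 ⟩ ∗ R N ∗ exp (⟨ T ⟩ * y₂) ∗ alternatingSum (Q ^ˢ P) a)) n
      ≈⟨ alternatingSum-product (const ⟨ 2 ⟩) (R M) (R N) (R P) (exp (⟨ T ⟩ * y₁)) (exp (⟨ T ⟩ * y₂))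
           (Q ^ˢ P) a odd (R-inverse P) n ⟩
    (X ∗ (const 1# ⊞ (Q ^ˢ P) ^ˢ a) ∗ RRR) n
      ≈⟨ ∗-cong {g = RRR} (∗-cong {f = X} S.refl (S.+-congˡ {x = const 1#} QPa)) S.refl n ⟩
    symmetricSeries M N P T y₁ y₂ n ∎))
    where
    M = a ℕ.* b
    N = a ℕ.* c
    P = b ℕ.* c
    T = a ℕ.* b ℕ.* c
    X = const ⟨ 2 ⟩ ∗ const ⟨ 2 ⟩ ∗ exp (⟨ T ⟩ * y₁) ∗ exp (⟨ T ⟩ * y₂)
    RRR = R M ∗ R N ∗ R P
    QPa : (Q ^ˢ P) ^ˢ a ≋ Q ^ˢ T
    QPa = S.trans (S^.^-assocʳ Q P a) (S.reflexive (≡.cong (Q ^ˢ_)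
      (≡.trans (ℕ.*-comm P a) (≡.sym (ℕ.*-assoc a b c)))))

  symmetricSeries-swap₁₂ : ∀ M N P T y₁ y₂ → symmetricSeries M N P T y₁ y₂ ≋ symmetricSeries N M P T y₁ y₂
  symmetricSeries-swap₁₂ M N P T y₁ y₂ =
    ∗-cong {f = numerator T y₁ y₂} S.refl (∗-cong {g = R P} (∗-comm (R M) (R N)) S.refl)

  symmetricSeries-swap₂₃ : ∀ M N P T y₁ y₂ → symmetricSeries M N P T y₁ y₂ ≋ symmetricSeries M P N T y₁ y₂
  symmetricSeries-swap₂₃ M N P T y₁ y₂ = ∗-cong {f = numerator T y₁ y₂} S.refl
    (S.trans (∗-assoc (R M) (R N) (R P)) (S.trans (∗-cong {f = R M} S.refl (∗-comm (R N) (R P)))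
      (S.sym (∗-assoc (R M) (R P) (R N)))))

-- Magnitudes, and numerals in ℚ

𝟏 : Magnitude
𝟏 = p^ 0ℚ

⊔ᵐ-lub-< : ∀ {a b c} → a <ᵐ c → b <ᵐ c → a ⊔ᵐ b <ᵐ c
⊔ᵐ-lub-< {𝟎}    {b}    a<c b<c = b<c
⊔ᵐ-lub-< {p^ s} {𝟎}    a<c b<c = a<c
⊔ᵐ-lub-< {p^ s} {p^ t} a<c b<c with ℚ.⊔-sel s t
... | inj₁ s⊔t≡s rewrite s⊔t≡s = a<c
... | inj₂ s⊔t≡t rewrite s⊔t≡t = b<c

·-<𝟏 : ∀ {a b} → a <ᵐ 𝟏 → b <ᵐ 𝟏 → a · b <ᵐ 𝟏
·-<𝟏 {𝟎}    {_}    _             _             = Strict.⊥₋<[ _ ]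
·-<𝟏 {p^ s} {𝟎}    _             _             = Strict.⊥₋<[ _ ]
·-<𝟏 {p^ s} {p^ t} Strict.[ s<0 ] Strict.[ t<0 ] = Strict.[ ℚ.+-mono-< s<0 t<0 ]

𝟏·-identity : ∀ a → 𝟏 · a ≡ a
𝟏·-identity 𝟎      = ≡.refl
𝟏·-identity (p^ s) = ≡.cong p^ (ℚ.+-identityˡ s)

𝟏≮𝟏 : ¬ 𝟏 <ᵐ 𝟏
𝟏≮𝟏 Strict.[ 0<0 ] = ℚ.<-irrefl ≡.refl 0<0

radius<𝟏 : ∀ p (pr : Prime p) → radius p pr <ᵐ 𝟏
radius<𝟏 (suc (suc m)) _ = Strict.[ ℚ.neg-antimono-< (ℚ.positive⁻¹ (ℤ.+ 1 ℚ./ suc m) {{ℚ.normalize-pos 1 (suc m)}}) ]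

ord≡0 : ∀ {p n} → ¬ p ∣ n → ord p n ≡ 0
ord≡0 {p} {n} p∤n = ≡.cong length (filter-none (λ k → p ℕ.^ suc k ∣? n)
  (All.universal (λ k pᵏ⁺¹∣n → p∤n (∣-trans (m∣m*n (p ℕ.^ k)) pᵏ⁺¹∣n)) (upTo n)))

∣∣ℚ≡𝟎⇒≡0 : ∀ {p} x → ∣ x ∣ℚ[ p ] ≡ 𝟎 → x ≡ 0ℚ
∣∣ℚ≡𝟎⇒≡0 x eq with ℤ.∣ ℚ.↥ x ∣ in ∣↥x∣≡0
... | zero = ℚ.↥p≡0⇒p≡0 x (ℤ.∣i∣≡0⇒i≡0 ∣↥x∣≡0)

module _ {a m₁ m₂ c ℓ₁ ℓ₂} {F : HeytingField a m₁ m₂} {L : HeytingField c ℓ₁ ℓ₂}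
  {ι : HeytingField.Carrier F → HeytingField.Carrier L}
  (hom : IsRingHomomorphism (FieldOps.rawRing F) (FieldOps.rawRing L) ι) where
  private
    module F = FieldOps F
    module L = FieldOps L
  open IsRingHomomorphism hom

  ⟨⟩-homo : ∀ n → ι F.⟨ n ⟩ L.≈ L.⟨ n ⟩
  ⟨⟩-homo zero    = 0#-homo
  ⟨⟩-homo (suc n) = L.trans (+-homo _ _) (L.+-cong 1#-homo (⟨⟩-homo n))

  -1-homo : ι (F.- F.1#) L.≈ L.- L.1#
  -1-homo = L.trans (-‿homo _) (L.-‿cong 1#-homo)

module ℚ-Field = FieldOps ℚ.heytingField

0≤⟨⟩ : ∀ n → 0ℚ ℚ.≤ ℚ-Field.⟨ n ⟩
0<⟨⟩ : ∀ n → 0ℚ ℚ.< ℚ-Field.⟨ suc n ⟩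
0≤⟨⟩ zero    = ℚ.≤-refl
0≤⟨⟩ (suc n) = ℚ.<⇒≤ (0<⟨⟩ n)
0<⟨⟩ n       = ℚ.+-mono-<-≤ (ℚ.positive⁻¹ 1ℚ) (0≤⟨⟩ n)

-- Absolute values of numerals and of qᵐ ± 1 in ℂₚ

module Tower {p c ℓ₁ ℓ₂} (p-prime : Prime p) (p-odd : Odd p) (tower : PAdicTower p c ℓ₁ ℓ₂) where
  open PAdicTower tower
  private
    module C₁ = IsCompletion isCompletion₁
    module C₂ = IsValuedAlgebraicClosure isValuedAlgebraicClosure
    module C₃ = IsCompletion isCompletion₃

  open ValuedField ℂₚ
  open Geometric commutativeRing using (-1*-1≈1)
  open SemiringSolver (CommutativeRing.commutativeSemiring commutativeRing) using (solve; _:=_; _:+_; _:*_; con)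

  ι : ℚ → Carrier
  ι x = ι₃ (ι₂ (ι₁ x))

  ∣ι∣ : ∀ x → ∣ ι x ∣ ≡ ∣ x ∣ℚ[ p ]
  ∣ι∣ x = ≡.trans (C₃.isometry _) (≡.trans (C₂.isometry _) (C₁.isometry x))

  private
    ι₃-cong : ∀ {x y} → x ℚₚᵃ.≈ y → ι₃ x ≈ ι₃ y
    ι₃-cong = IsRingHomomorphism.⟦⟧-cong C₃.isRingHomomorphism
    ι₂-cong : ∀ {x y} → x ℚₚ.≈ y → ι₂ x ℚₚᵃ.≈ ι₂ y
    ι₂-cong = IsRingHomomorphism.⟦⟧-cong C₂.isRingHomomorphism

  ι-⟨⟩ : ∀ n → ι ℚ-Field.⟨ n ⟩ ≈ ⟨ n ⟩
  ι-⟨⟩ n = trans (ι₃-cong (ℚₚᵃ.trans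
    (ι₂-cong (⟨⟩-homo {F = ℚ.heytingField} {L = ℚₚ.heytingField} C₁.isRingHomomorphism n))
    (⟨⟩-homo {F = ℚₚ.heytingField} {L = ℚₚᵃ.heytingField} C₂.isRingHomomorphism n)))
    (⟨⟩-homo {F = ℚₚᵃ.heytingField} {L = heytingField} C₃.isRingHomomorphism n)

  ι--1 : ι (ℚ-Field.- 1ℚ) ≈ - 1#
  ι--1 = trans (ι₃-cong (ℚₚᵃ.trans
    (ι₂-cong (-1-homo {F = ℚ.heytingField} {L = ℚₚ.heytingField} C₁.isRingHomomorphism))
    (-1-homo {F = ℚₚ.heytingField} {L = ℚₚᵃ.heytingField} C₂.isRingHomomorphism)))
    (-1-homo {F = ℚₚᵃ.heytingField} {L = heytingField} C₃.isRingHomomorphism)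

  -- All three embeddings are isometric and preserve numerals, so the question moves to ℚ. There the
  -- absolute value vanishes only at 0, and the numeral is positive.
  ∣⟨⟩∣≢𝟎 : ∀ n → .{{NonZero n}} → ∣ ⟨ n ⟩ ∣ ≢ 𝟎
  ∣⟨⟩∣≢𝟎 (suc n) ∣n∣≡𝟎 = ℚ.<-irrefl (≡.sym (∣∣ℚ≡𝟎⇒≡0 ℚ-Field.⟨ suc n ⟩
    (≡.trans (≡.sym (∣ι∣ _)) (≡.trans (∣∣-cong (ι-⟨⟩ (suc n))) ∣n∣≡𝟎)))) (0<⟨⟩ n)

  ∣0∣≡𝟎 : ∣ 0# ∣ ≡ 𝟎
  ∣0∣≡𝟎 = ≡.trans (≡.sym (∣∣-cong (ι-⟨⟩ 0))) (∣ι∣ _)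

  ∤1 : ¬ p ∣ 1
  ∤1 = small p-prime
    where
    small : ∀ {p} → Prime p → ¬ p ∣ 1
    small {zero}        pr _   = ¬prime[0] pr
    small {suc zero}    pr _   = ¬prime[1] pr
    small {suc (suc p)} pr p∣1 with ∣⇒≤ p∣1
    ... | ℕ.s≤s ()

  ∤2 : ¬ p ∣ 2
  ∤2 = small p-prime p-odd
    where
    small : ∀ {p} → Prime p → Odd p → ¬ p ∣ 2
    small {zero}              pr odd _   = ¬prime[0] pr
    small {suc zero}          pr odd _   = ¬prime[1] pr
    small {suc (suc zero)}    pr odd _   = odd ∣-refl
    small {suc (suc (suc p))} pr odd p∣2 with ∣⇒≤ p∣2
    ... | ℕ.s≤s (ℕ.s≤s ())

  -- As p is odd, it divides neither 2 nor the denominator 1. Both multiplicities are 0, and the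
  -- exponent 0/1 evaluates to `0ℚ`.
  ∣2∣≡𝟏 : ∣ ⟨ 2 ⟩ ∣ ≡ 𝟏
  ∣2∣≡𝟏 = ≡.trans (≡.sym (∣∣-cong (ι-⟨⟩ 2))) (≡.trans (∣ι∣ _)
    (≡.cong₂ (λ k l → p^ ((ℤ.+ k ℤ.- ℤ.+ l) ℚ./ 1)) (ord≡0 ∤1) (ord≡0 ∤2)))

  ∣-1∣≡𝟏 : ∣ - 1# ∣ ≡ 𝟏
  ∣-1∣≡𝟏 = ≡.trans (≡.sym (∣∣-cong ι--1)) (≡.trans (∣ι∣ _)
    (≡.cong₂ (λ k l → p^ ((ℤ.+ k ℤ.- ℤ.+ l) ℚ./ 1)) (ord≡0 ∤1) (ord≡0 ∤1)))

  +-<𝟏 : ∀ {x y} → ∣ x ∣ <ᵐ 𝟏 → ∣ y ∣ <ᵐ 𝟏 → ∣ x + y ∣ <ᵐ 𝟏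
  +-<𝟏 {x} {y} x<1 y<1 = Strict.<₋-transʳ ℚ.≤-<-trans (∣∣-ultraNorm x y) (⊔ᵐ-lub-< x<1 y<1)

  *-<𝟏 : ∀ {x y} → ∣ x ∣ <ᵐ 𝟏 → ∣ y ∣ <ᵐ 𝟏 → ∣ x * y ∣ <ᵐ 𝟏
  *-<𝟏 {x} {y} x<1 y<1 = ≡.subst (_<ᵐ 𝟏) (≡.sym (∣∣-homo-* x y)) (·-<𝟏 x<1 y<1)

  -1*-<𝟏 : ∀ {x} → ∣ x ∣ <ᵐ 𝟏 → ∣ - 1# * x ∣ <ᵐ 𝟏
  -1*-<𝟏 {x} x<1 = ≡.subst (_<ᵐ 𝟏)
    (≡.sym (≡.trans (∣∣-homo-* (- 1#) x) (≡.trans (≡.cong (_· ∣ x ∣) ∣-1∣≡𝟏) (𝟏·-identity ∣ x ∣)))) x<1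

  -- Since xy - 1 = (x - 1)(y - 1) + (y - 1) + (x - 1), the ultrametric inequality makes the open
  -- unit disc around 1 stable under products.
  qᵐ-1<𝟏 : ∀ {q} → ∣ q - 1# ∣ <ᵐ 𝟏 → ∀ m → ∣ q ^ m - 1# ∣ <ᵐ 𝟏
  qᵐ-1<𝟏 {q} q-1<1 zero    = ≡.subst (_<ᵐ 𝟏)
    (≡.sym (≡.trans (∣∣-cong (-‿inverseʳ 1#)) ∣0∣≡𝟎)) Strict.⊥₋<[ _ ]
  qᵐ-1<𝟏 {q} q-1<1 (suc m) = ≡.subst (_<ᵐ 𝟏) (∣∣-cong (identity q (q ^ m)))
    (+-<𝟏 (+-<𝟏 (*-<𝟏 q-1<1 (qᵐ-1<𝟏 q-1<1 m)) (qᵐ-1<𝟏 q-1<1 m)) q-1<1)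
    where
    identity : ∀ x y → (x - 1#) * (y - 1#) + (y - 1#) + (x - 1#) ≈ x * y - 1#
    identity x y = trans
      (solve 3 (λ x y e → (x :+ e) :* (y :+ e) :+ (y :+ e) :+ (x :+ e)
        := x :* y :+ e :+ (con 1 :+ e) :* (x :+ y :+ e)) refl x y (- 1#))
      (trans (+-congˡ (trans (*-congʳ (-‿inverseʳ 1#)) (zeroˡ _))) (+-identityʳ _))

  -- If qᵐ + 1 had absolute value 0, then 2 = (qᵐ + 1) - (qᵐ - 1) would have absolute value below 1,
  -- against ∣ 2 ∣ = 1.
  ∣qᵐ+1∣≢𝟎 : ∀ {q} → ∣ q - 1# ∣ <ᵐ 𝟏 → ∀ m → ∣ q ^ m + 1# ∣ ≢ 𝟎
  ∣qᵐ+1∣≢𝟎 {q} q-1<1 m qᵐ+1≡𝟎 = 𝟏≮𝟏 (≡.subst (_<ᵐ 𝟏) (≡.trans (∣∣-cong (identity (q ^ m))) ∣2∣≡𝟏)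
    (+-<𝟏 (≡.subst (_<ᵐ 𝟏) (≡.sym qᵐ+1≡𝟎) Strict.⊥₋<[ _ ]) (-1*-<𝟏 (qᵐ-1<𝟏 q-1<1 m))))
    where
    identity : ∀ x → (x + 1#) + - 1# * (x - 1#) ≈ ⟨ 2 ⟩
    identity x = trans
      -- `⟨ 2 ⟩` unfolds to `1# + (1# + 0#)`, hence the trailing zero; e² = 1 supplies the second 1.
      (solve 2 (λ x e → (x :+ con 1) :+ e :* (x :+ e) := (con 1 :+ e) :* x :+ (con 1 :+ (e :* e :+ con 0))) refl x (- 1#))
      (trans (+-cong (trans (*-congʳ (-‿inverseʳ 1#)) (zeroˡ x)) (+-congˡ (+-congʳ -1*-1≈1))) (+-identityˡ _))

-- Comparison of the six expressions

theorem4p5 : ∀ {c ℓ₁ ℓ₂} (p : ℕ) (p-prime : Prime p) → Odd p →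
  (tower : PAdicTower p c ℓ₁ ℓ₂) →
  let open PAdicTower tower
      open ValuedField ℂₚ
      open Euler ℂₚ
  in (q : Carrier) → ∣ q - 1# ∣ <ᵐ radius p p-prime →
  (w₁ w₂ w₃ : ℕ) → Odd w₁ → Odd w₂ → Odd w₃ →
  (n : ℕ) (z₁ z₂ : ℤₚ) →
  let y₁ = fromℤₚ z₁
      y₂ = fromℤₚ z₂
      line₁ = ⟨ w₁ ⟩ ^ n * ∑[ k ≤ n ]
        ( ⟨ n C toℕ k ⟩ * E[ toℕ k , q ^ (w₁ ℕ.* w₂) ] (⟨ w₃ ⟩ * y₁)
        * ⟨ w₃ ⟩ ^ (n ∸ toℕ k) * ⟨ w₂ ⟩ ^ toℕ k
        * ∑[ i < w₁ ] ( (- 1#) ^ toℕ i * q ^ (w₂ ℕ.* w₃ ℕ.* toℕ i)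
          * E[ n ∸ toℕ k , q ^ (w₁ ℕ.* w₃) ] (⟨ w₂ ⟩ * y₂ + ⟨ w₂ ⟩ / ⟨ w₁ ⟩ * ⟨ toℕ i ⟩)))
      line₂ = ⟨ w₁ ⟩ ^ n * ∑[ k ≤ n ]
        ( ⟨ n C toℕ k ⟩ * E[ toℕ k , q ^ (w₁ ℕ.* w₃) ] (⟨ w₂ ⟩ * y₁)
        * ⟨ w₂ ⟩ ^ (n ∸ toℕ k) * ⟨ w₃ ⟩ ^ toℕ k
        * ∑[ i < w₁ ] ( (- 1#) ^ toℕ i * q ^ (w₂ ℕ.* w₃ ℕ.* toℕ i)
          * E[ n ∸ toℕ k , q ^ (w₁ ℕ.* w₂) ] (⟨ w₃ ⟩ * y₂ + ⟨ w₃ ⟩ / ⟨ w₁ ⟩ * ⟨ toℕ i ⟩)))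
      line₃ = ⟨ w₂ ⟩ ^ n * ∑[ k ≤ n ]
        ( ⟨ n C toℕ k ⟩ * E[ toℕ k , q ^ (w₁ ℕ.* w₂) ] (⟨ w₃ ⟩ * y₁)
        * ⟨ w₃ ⟩ ^ (n ∸ toℕ k) * ⟨ w₁ ⟩ ^ toℕ k
        * ∑[ i < w₂ ] ( (- 1#) ^ toℕ i * q ^ (w₁ ℕ.* w₃ ℕ.* toℕ i)
          * E[ n ∸ toℕ k , q ^ (w₂ ℕ.* w₃) ] (⟨ w₁ ⟩ * y₂ + ⟨ w₁ ⟩ / ⟨ w₂ ⟩ * ⟨ toℕ i ⟩)))
      line₄ = ⟨ w₂ ⟩ ^ n * ∑[ k ≤ n ]
        ( ⟨ n C toℕ k ⟩ * E[ toℕ k , q ^ (w₂ ℕ.* w₃) ] (⟨ w₁ ⟩ * y₁)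
        * ⟨ w₁ ⟩ ^ (n ∸ toℕ k) * ⟨ w₃ ⟩ ^ toℕ k
        * ∑[ i < w₂ ] ( (- 1#) ^ toℕ i * q ^ (w₁ ℕ.* w₃ ℕ.* toℕ i)
          * E[ n ∸ toℕ k , q ^ (w₁ ℕ.* w₂) ] (⟨ w₃ ⟩ * y₂ + ⟨ w₃ ⟩ / ⟨ w₂ ⟩ * ⟨ toℕ i ⟩)))
      line₅ = ⟨ w₃ ⟩ ^ n * ∑[ k ≤ n ]
        ( ⟨ n C toℕ k ⟩ * E[ toℕ k , q ^ (w₁ ℕ.* w₃) ] (⟨ w₂ ⟩ * y₁)
        * ⟨ w₂ ⟩ ^ (n ∸ toℕ k) * ⟨ w₁ ⟩ ^ toℕ k
        * ∑[ i < w₃ ] ( (- 1#) ^ toℕ i * q ^ (w₁ ℕ.* w₂ ℕ.* toℕ i)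
          * E[ n ∸ toℕ k , q ^ (w₂ ℕ.* w₃) ] (⟨ w₁ ⟩ * y₂ + ⟨ w₁ ⟩ / ⟨ w₃ ⟩ * ⟨ toℕ i ⟩)))
      line₆ = ⟨ w₃ ⟩ ^ n * ∑[ k ≤ n ]
        ( ⟨ n C toℕ k ⟩ * E[ toℕ k , q ^ (w₂ ℕ.* w₃) ] (⟨ w₁ ⟩ * y₁)
        * ⟨ w₁ ⟩ ^ (n ∸ toℕ k) * ⟨ w₂ ⟩ ^ toℕ k
        * ∑[ i < w₃ ] ( (- 1#) ^ toℕ i * q ^ (w₁ ℕ.* w₂ ℕ.* toℕ i)
          * E[ n ∸ toℕ k , q ^ (w₁ ℕ.* w₃) ] (⟨ w₂ ⟩ * y₂ + ⟨ w₂ ⟩ / ⟨ w₃ ⟩ * ⟨ toℕ i ⟩)))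
  in (line₁ ≈ line₂) × (line₂ ≈ line₃) × (line₃ ≈ line₄)
     × (line₄ ≈ line₅) × (line₅ ≈ line₆)
theorem4p5 p p-prime p-odd tower q ∣q-1∣<radius w₁ w₂ w₃ odd₁ odd₂ odd₃ n z₁ z₂ =
    -- Each expression comes with its own order of the reciprocals of index ab, ac, bc. A link is
    -- the permutation between two neighbouring orders, written in adjacent transpositions.
    chain line₁ line₂ (swap₁₂ w₁₂ w₁₃ w₂₃)
  , chain line₂ line₃ (S.trans (swap₁₂ w₁₃ w₁₂ w₂₃) (swap₂₃ w₁₂ w₁₃ w₂₃))
  , chain line₃ line₄ (swap₁₂ w₁₂ w₂₃ w₁₃)
  , chain line₄ line₅ (S.trans (swap₂₃ w₂₃ w₁₂ w₁₃) (swap₁₂ w₂₃ w₁₃ w₁₂))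
  , chain line₅ line₆ (swap₁₂ w₁₃ w₂₃ w₁₂)
  where
  open PAdicTower tower
  open ValuedField ℂₚ using (Carrier; _≈_; _*_; ⟨_⟩; trans; sym; *-congˡ)
  open Euler ℂₚ using (Series)
  open PowerSeries ℂₚ using (_≋_; module S)
  open Tower p-prime p-odd tower using (∣⟨⟩∣≢𝟎; ∣qᵐ+1∣≢𝟎)
  open EulerSymmetry ℂₚ ∣⟨⟩∣≢𝟎 q
    -- The radius p^(-1/(p-1)) is less than 1, so ∣ q - 1 ∣ < 1 and every qᵐ + 1 is nonzero.
    (∣qᵐ+1∣≢𝟎 (Strict.<₋-trans ℚ.<-trans ∣q-1∣<radius (radius<𝟏 p p-prime)))
  y₁ = fromℤₚ z₁
  y₂ = fromℤₚ z₂
  w₁₂ = w₁ ℕ.* w₂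
  w₁₃ = w₁ ℕ.* w₃
  w₂₃ = w₂ ℕ.* w₃
  T = w₁ ℕ.* w₂ ℕ.* w₃

  swap₁₂ : ∀ M N P → symmetricSeries M N P T y₁ y₂ ≋ symmetricSeries N M P T y₁ y₂
  swap₁₂ M N P = symmetricSeries-swap₁₂ M N P T y₁ y₂
  swap₂₃ : ∀ M N P → symmetricSeries M N P T y₁ y₂ ≋ symmetricSeries M P N T y₁ y₂
  swap₂₃ M N P = symmetricSeries-swap₂₃ M N P T y₁ y₂

  chain : ∀ {x y} {f g : Series} → x ≈ ⟨ n ! ⟩ * f n → y ≈ ⟨ n ! ⟩ * g n → f ≋ g → x ≈ y
  chain x≈f y≈g f≋g = trans x≈f (trans (*-congˡ (f≋g n)) (sym y≈g))

  -- The triple (a, b, c) is read off from the expression: a bounds the inner sum, b is raised to k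
  -- and c to n - k.
  line₁ = line≈symmetricSeries {w₁} {w₂} {w₃} {w₁₂} {w₁₃} {w₂₃} {T} odd₁ ≡.refl ≡.refl ≡.refl ≡.refl n y₁ y₂
  line₂ = line≈symmetricSeries {w₁} {w₃} {w₂} {w₁₃} {w₁₂} {w₂₃} {T} odd₁ ≡.refl ≡.refl (ℕ.*-comm w₂ w₃) (acb w₁ w₂ w₃) n y₁ y₂
    where
    acb : ∀ a b c → a ℕ.* b ℕ.* c ≡ a ℕ.* c ℕ.* b
    acb = solve-∀
  line₃ = line≈symmetricSeries {w₂} {w₁} {w₃} {w₁₂} {w₂₃} {w₁₃} {T} odd₂ (ℕ.*-comm w₁ w₂) ≡.refl ≡.refl (bac w₁ w₂ w₃) n y₁ y₂
    where
    bac : ∀ a b c → a ℕ.* b ℕ.* c ≡ b ℕ.* a ℕ.* c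
    bac = solve-∀
  line₄ = line≈symmetricSeries {w₂} {w₃} {w₁} {w₂₃} {w₁₂} {w₁₃} {T} odd₂ ≡.refl (ℕ.*-comm w₁ w₂) (ℕ.*-comm w₁ w₃) (bca w₁ w₂ w₃) n y₁ y₂
    where
    bca : ∀ a b c → a ℕ.* b ℕ.* c ≡ b ℕ.* c ℕ.* a
    bca = solve-∀
  line₅ = line≈symmetricSeries {w₃} {w₁} {w₂} {w₁₃} {w₂₃} {w₁₂} {T} odd₃ (ℕ.*-comm w₁ w₃) (ℕ.*-comm w₂ w₃) ≡.refl (cab w₁ w₂ w₃) n y₁ y₂
    where
    cab : ∀ a b c → a ℕ.* b ℕ.* c ≡ c ℕ.* a ℕ.* b
    cab = solve-∀
  line₆ = line≈symmetricSeries {w₃} {w₂} {w₁} {w₂₃} {w₁₃} {w₁₂} {T} odd₃ (ℕ.*-comm w₂ w₃) (ℕ.*-comm w₁ w₃) (ℕ.*-comm w₁ w₂) (cba w₁ w₂ w₃) n y₁ y₂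
    where
    cba : ∀ a b c → a ℕ.* b ℕ.* c ≡ c ℕ.* b ℕ.* a
    cba = solve-∀
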